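{- Let $p$ be an odd prime and $m,r$ positive integers. Then $S_{mp^r+1}\equiv 4(mp^r+1)S_{mp^{r-1}}\pmod{p^{2r}}$.
   Context: $(S_n)_{n\ge0}$ is the integer sequence defined by $S_0=1$, $S_1=4$ and $(n+1)^2S_{n+1}=4(3n^2+3n+1)S_n-32n^2S_{n-1}$ for $n\ge1$; equivalently $S_n=\sum_{k=0}^n\binom nk\binom{2k}k\binom{2n-2k}{n-k}$. -}

module Defs where

open import Data.Nat as ℕ using (ℕ; _∸_)
open import Data.Integer using (ℤ; +_; _+_; _-_; _*_; _^_)
open import Data.Integer.Divisibility.Signed using (_∣_)
open import Relation.Binary.PropositionalEquality using (_≡_)

-- The two initial values and the recurrence determine the sequence, since
-- the leading coefficient (n+1)² is nonzero. The solution is integral: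
-- S n = Σ_{k=0}^{n} C(n,k) C(2k,k) C(2n-2k,n-k).
-- The truncated n ∸ 1 is only used for n ≥ 1.
record IsS (S : ℕ → ℤ) : Set where
  field
    S-zero : S 0 ≡ + 1
    S-one  : S 1 ≡ + 4
    S-rec  : ∀ n → 1 ℕ.≤ n →
             (+ n + + 1) ^ 2 * S (n ℕ.+ 1)
               ≡ + 4 * (+ 3 * (+ n) ^ 2 + + 3 * + n + + 1) * S n
                 - + 32 * (+ n) ^ 2 * S (n ∸ 1)

infix 4 _≡_[mod_]

_≡_[mod_] : ℤ → ℤ → ℤ → Set
a ≡ b [mod d ] = d ∣ a - b

{-# OPTIONS --safe #-}
module Submission where

-- Let t(k,l) = C(k+l,k) C(2k,k) C(2l,l), so that S n = Σ_{k+l=n} t(k,l). With the super Catalan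
-- integers T(k,l) = (2k)!(2l)!/(k! l! (k+l)!) one has t(k,l) = C(k+l,k)² T(k,l), hence p^{2(r-s)}
-- divides t(k,l) whenever p^r ∣ k+l and p^s is the power of p in k, s ≤ r.  Modulo p^{2r} only the
-- terms with p ∣ k survive in S(np), p^r ∣ np.  The ratio t(pk,pl)/t(k,l) is a quotient of the
-- products F(n) = (pn)!/(pⁿ n!), and F(a+b) ≡ F(a)F(b) mod p^{2s+2} if p^s ∣ a, b; the loss in this
-- modulus is compensated by the divisibility of t(k,l), so S(np) ≡ S(n) mod p^{2r}.  The recurrence
-- at an index n divisible by p^r gives S(n+1) ≡ 4(n+1) S(n) mod p^{2r}.

open import Defs
open import Data.Nat using (ℕ; NonZero; _<_; zero; suc; _+_; _*_; _^_; _∸_; _≤_; s≤s; z≤n; _!)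
import Data.Nat.Properties as ℕ
open import Data.Nat.Combinatorics using (_C_; nCk≡n!/k![n-k]!; k![n∸k]!∣n!)
open import Data.Nat.Divisibility using (_∣_)
import Data.Nat.Divisibility as ℕ
open import Data.Nat.DivMod using (m/n*n≡m)
open import Data.Nat.Primality using (Prime; euclidsLemma; prime⇒nonZero; ¬prime[0]; ¬prime[1])
open import Data.Integer as ℤ using (ℤ; +_; 0ℤ; 1ℤ; -_)
  renaming (_+_ to _+ᶻ_; _*_ to _*ᶻ_; _-_ to _-ᶻ_; _^_ to _^ᶻ_)
import Data.Integer.Properties as ℤ
open import Data.Integer.Divisibility.Signed as ℤ using (divides)
  renaming (_∣_ to _∣ᶻ_)
open import Data.Integer.Tactic.RingSolver using (solve-∀)
import Data.Nat.Tactic.RingSolver as ℕ-Ring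
open import Algebra.Bundles using (CommutativeSemigroup)
open import Algebra.Structures using (IsCommutativeSemigroup)
import Algebra.Properties.CommutativeSemigroup as CommutativeSemigroupProperties
open import Data.Product using (_×_; _,_; ∃-syntax; proj₁)
open import Data.Sum using (_⊎_; inj₁; inj₂; [_,_]′)
open import Data.Empty using (⊥-elim)
open import Function using (_∘_; flip)
open import Relation.Nullary using (¬_; yes; no)
open import Relation.Binary.PropositionalEquality
  using (_≡_; refl; sym; trans; cong; cong₂; subst; subst₂; module ≡-Reasoning)
open ≡-Reasoning

-- Folds over the antidiagonal k + l = n

module Antidiagonal {A : Set} (_∙_ : A → A → A) where

  -- Both indices are passed to the term, so no truncated subtraction occurs and reversing the order
  -- is just `flip`. The fold is never empty: index `n` gives n + 1 terms.
  diag : (ℕ → ℕ → A) → ℕ → A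
  diag f zero    = f 0 0
  diag f (suc n) = f 0 (suc n) ∙ diag (λ k l → f (suc k) l) n

  -- One induction serves three purposes: equality of folds, congruence of folds, and, with an `R`
  -- that ignores its second argument, properties closed under the operation.
  diag-rel : (R : A → A → Set) →
    (∀ {a b c d} → R a b → R c d → R (a ∙ c) (b ∙ d)) →
    ∀ {f g} n → (∀ k l → k + l ≡ n → R (f k l) (g k l)) →
    R (diag f n) (diag g n)
  diag-rel R R-∙ zero    h = h 0 0 refl
  diag-rel R R-∙ (suc n) h =
    R-∙ (h 0 (suc n) refl) (diag-rel R R-∙ n (λ k l eq → h (suc k) l (cong suc eq)))

  diag-cong : ∀ {f g} n → (∀ k l → k + l ≡ n → f k l ≡ g k l) →
    diag f n ≡ diag g n
  diag-cong = diag-rel _≡_ (cong₂ _∙_)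

  module _ (isCommutativeSemigroup : IsCommutativeSemigroup _≡_ _∙_) where

    private
      open module S = IsCommutativeSemigroup isCommutativeSemigroup using (assoc; comm)
      bundle : CommutativeSemigroup _ _
      bundle = record { isCommutativeSemigroup = isCommutativeSemigroup }
    open CommutativeSemigroupProperties bundle using (interchange)

    diag-last : ∀ f n → diag f (suc n) ≡ diag (λ k l → f k (suc l)) n ∙ f (suc n) 0
    diag-last f zero    = refl
    diag-last f (suc n) = trans
      (cong (f 0 (suc (suc n)) ∙_) (diag-last (λ k l → f (suc k) l) n))
      (sym (assoc _ _ _))

    diag-flip : ∀ f n → diag f n ≡ diag (flip f) n
    diag-flip f zero    = refl
    diag-flip f (suc n) = begin
      f 0 (suc n) ∙ diag (λ k l → f (suc k) l) n  ≡⟨ cong (_ ∙_) (diag-flip _ n) ⟩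
      f 0 (suc n) ∙ diag (λ k l → f (suc l) k) n  ≡⟨ comm _ _ ⟩
      diag (λ k l → f (suc l) k) n ∙ f 0 (suc n)  ≡⟨ diag-last (flip f) n ⟨
      diag (flip f) (suc n)                       ∎

    diag-∙ : ∀ f g n → diag (λ k l → f k l ∙ g k l) n ≡ diag f n ∙ diag g n
    diag-∙ f g zero    = refl
    diag-∙ f g (suc n) =
      trans (cong (_ ∙_) (diag-∙ _ _ n)) (interchange _ _ _ _)

open Antidiagonal _+ᶻ_ using () renaming
  (diag to ∑; diag-rel to ∑-rel; diag-cong to ∑-cong; diag-∙ to ∑-∙; diag-flip to ∑-∙-flip)
open Antidiagonal _*ᶻ_ using () renaming
  (diag to ∏; diag-rel to ∏-rel; diag-cong to ∏-cong; diag-∙ to ∏-∙; diag-flip to ∏-∙-flip; diag-last to ∏-∙-last)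

∑-+ : ∀ f g n → ∑ (λ k l → f k l +ᶻ g k l) n ≡ ∑ f n +ᶻ ∑ g n
∑-+ = ∑-∙ ℤ.+-isCommutativeSemigroup

∑-flip : ∀ f n → ∑ f n ≡ ∑ (flip f) n
∑-flip = ∑-∙-flip ℤ.+-isCommutativeSemigroup

∑-*ˡ : ∀ c f n → ∑ (λ k l → c *ᶻ f k l) n ≡ c *ᶻ ∑ f n
∑-*ˡ c f zero    = refl
∑-*ˡ c f (suc n) =
  trans (cong (c *ᶻ f 0 (suc n) +ᶻ_) (∑-*ˡ c f′ n)) (sym (ℤ.*-distribˡ-+ c (f 0 (suc n)) (∑ f′ n)))
  where
  f′ : ℕ → ℕ → ℤ
  f′ k l = f (suc k) l

∏-* : ∀ f g n → ∏ (λ k l → f k l *ᶻ g k l) n ≡ ∏ f n *ᶻ ∏ g n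
∏-* = ∏-∙ ℤ.*-isCommutativeSemigroup

∏-flip : ∀ f n → ∏ f n ≡ ∏ (flip f) n
∏-flip = ∏-∙-flip ℤ.*-isCommutativeSemigroup

∏-last : ∀ f n → ∏ f (suc n) ≡ ∏ (λ k l → f k (suc l)) n *ᶻ f (suc n) 0
∏-last = ∏-∙-last ℤ.*-isCommutativeSemigroup

-- The summand C(k+l,k)² T(k,l) with T the super Catalan numbers

fac : ℕ → ℤ
fac n = + (n !)

fac≢0 : ∀ n → ℤ.NonZero (fac n)
fac≢0 n = n ℕ.!≢0

fac-suc : ∀ n → fac (suc n) ≡ (1ℤ +ᶻ + n) *ᶻ fac n
fac-suc n = ℤ.pos-* (suc n) (n !)

fac-double-suc : ∀ k → fac (suc k + suc k) ≡
  (+ 2 *ᶻ + k +ᶻ + 2) *ᶻ (+ 2 *ᶻ + k +ᶻ + 1) *ᶻ fac (k + k)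
fac-double-suc k = begin
  fac (suc k + suc k)                        ≡⟨ cong (fac ∘ suc) (ℕ.+-suc k k) ⟩
  fac (suc (suc (k + k)))                    ≡⟨ fac-suc (suc (k + k)) ⟩
  (1ℤ +ᶻ (1ℤ +ᶻ (+ k +ᶻ + k))) *ᶻ fac (suc (k + k))
                                             ≡⟨ cong ((1ℤ +ᶻ (1ℤ +ᶻ (+ k +ᶻ + k))) *ᶻ_) (fac-suc (k + k)) ⟩
  (1ℤ +ᶻ (1ℤ +ᶻ (+ k +ᶻ + k))) *ᶻ ((1ℤ +ᶻ (+ k +ᶻ + k)) *ᶻ fac (k + k))
                                             ≡⟨ identity (+ k) (fac (k + k)) ⟩
  _                                          ∎
  where
  identity : ∀ k x → (1ℤ +ᶻ (1ℤ +ᶻ (k +ᶻ k))) *ᶻ ((1ℤ +ᶻ (k +ᶻ k)) *ᶻ x)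
    ≡ (+ 2 *ᶻ k +ᶻ + 2) *ᶻ (+ 2 *ᶻ k +ᶻ + 1) *ᶻ x
  identity = solve-∀

choose : ℕ → ℕ → ℕ
choose k l = (k + l) C k

choose-! : ∀ k l → choose k l * (k ! * l !) ≡ (k + l) !
choose-! k l = begin
  choose k l * (k ! * l !)
    ≡⟨ cong (λ m → choose k l * (k ! * m !)) (ℕ.m+n∸m≡n k l) ⟨
  choose k l * (k ! * (k + l ∸ k) !)
    ≡⟨ cong (_* (k ! * (k + l ∸ k) !)) (nCk≡n!/k![n-k]! (ℕ.m≤m+n k l)) ⟩
  _
    ≡⟨ m/n*n≡m {{k ℕ.!* (k + l ∸ k) !≢0}} (k![n∸k]!∣n! (ℕ.m≤m+n k l)) ⟩
  (k + l) ! ∎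

-- This is the source of all divisibility of the binomial coefficients: a high power of p in k + l +
-- 1 that is not absorbed by k + 1 must divide `choose (suc k) l`.
choose-absorption : ∀ k l → suc k * choose (suc k) l ≡ suc (k + l) * choose k l
choose-absorption k l = ℕ.*-cancelʳ-≡ _ _ (k ! * l !) {{k ℕ.!* l !≢0}} (begin
  suc k * choose (suc k) l * (k ! * l !)
    ≡⟨ cong (_* (k ! * l !)) (ℕ.*-comm (suc k) (choose (suc k) l)) ⟩
  choose (suc k) l * suc k * (k ! * l !)
    ≡⟨ ℕ.*-assoc (choose (suc k) l) (suc k) (k ! * l !) ⟩
  choose (suc k) l * (suc k * (k ! * l !))
    ≡⟨ cong (choose (suc k) l *_) (ℕ.*-assoc (suc k) (k !) (l !)) ⟨
  choose (suc k) l * (suc k ! * l !)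
    ≡⟨ choose-! (suc k) l ⟩
  suc (k + l) * (k + l) !
    ≡⟨ cong (suc (k + l) *_) (choose-! k l) ⟨
  suc (k + l) * (choose k l * (k ! * l !))
    ≡⟨ ℕ.*-assoc (suc (k + l)) (choose k l) (k ! * l !) ⟨
  suc (k + l) * choose k l * (k ! * l !) ∎)

-- (2k)! (2l)! / (k! l! (k+l)!); the recursion shows that it is an integer.
superCatalan : ℕ → ℕ → ℤ
superCatalan k zero    = + choose k k
superCatalan k (suc l) = + 4 *ᶻ superCatalan k l -ᶻ superCatalan (suc k) l

superCatalan-fac : ∀ k l →
  superCatalan k l *ᶻ (fac k *ᶻ fac l *ᶻ fac (k + l)) ≡ fac (k + k) *ᶻ fac (l + l)
superCatalan-fac k zero = begin
  + choose k k *ᶻ (fac k *ᶻ 1ℤ *ᶻ fac (k + 0))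
    ≡⟨ cong₂ (λ x y → + choose k k *ᶻ (x *ᶻ y)) (ℤ.*-identityʳ (fac k)) (cong fac (ℕ.+-identityʳ k)) ⟩
  + choose k k *ᶻ (fac k *ᶻ fac k)
    ≡⟨ cong (+ choose k k *ᶻ_) (ℤ.pos-* (k !) (k !)) ⟨
  + choose k k *ᶻ + (k ! * k !)
    ≡⟨ ℤ.pos-* (choose k k) (k ! * k !) ⟨
  + (choose k k * (k ! * k !))
    ≡⟨ cong +_ (choose-! k k) ⟩
  fac (k + k)
    ≡⟨ ℤ.*-identityʳ _ ⟨
  fac (k + k) *ᶻ 1ℤ ∎
-- The factor k + 1 turns k! into (k+1)! in the `T′` term, so the induction hypothesis at `suc k`
-- applies. What remains is 4(k+l+1) - 2(2k+1) = 2(2l+1).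
superCatalan-fac k (suc l) = ℤ.*-cancelˡ-≡ (1ℤ +ᶻ + k) _ _ (begin
  (1ℤ +ᶻ + k) *ᶻ ((+ 4 *ᶻ T -ᶻ T′) *ᶻ (fac k *ᶻ fac (suc l) *ᶻ fac (k + suc l)))
    ≡⟨ cong₂ (λ x y → (1ℤ +ᶻ + k) *ᶻ ((+ 4 *ᶻ T -ᶻ T′) *ᶻ (fac k *ᶻ x *ᶻ y)))
         (fac-suc l) (trans (cong fac (ℕ.+-suc k l)) (fac-suc (k + l))) ⟩
  _ ≡⟨ expand (+ k) (+ l) (fac k) (fac l) (fac (k + l)) T T′ ⟩
  _ ≡⟨ cong₂ (λ x y → + 4 *ᶻ (1ℤ +ᶻ + k) *ᶻ (1ℤ +ᶻ + l) *ᶻ (1ℤ +ᶻ (+ k +ᶻ + l)) *ᶻ x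
                       -ᶻ (1ℤ +ᶻ + l) *ᶻ y)
         (superCatalan-fac k l) T′-fac ⟩
  _ ≡⟨ collect (+ k) (+ l) (fac (k + k)) (fac (l + l)) ⟩
  (1ℤ +ᶻ + k) *ᶻ (fac (k + k) *ᶻ ((+ 2 *ᶻ + l +ᶻ + 2) *ᶻ (+ 2 *ᶻ + l +ᶻ + 1) *ᶻ fac (l + l)))
    ≡⟨ cong (λ x → (1ℤ +ᶻ + k) *ᶻ (fac (k + k) *ᶻ x)) (fac-double-suc l) ⟨
  (1ℤ +ᶻ + k) *ᶻ (fac (k + k) *ᶻ fac (suc l + suc l)) ∎)
  where
  T T′ : ℤ
  T  = superCatalan k l
  T′ = superCatalan (suc k) l

  T′-fac : T′ *ᶻ ((1ℤ +ᶻ + k) *ᶻ fac k *ᶻ fac l *ᶻ ((1ℤ +ᶻ (+ k +ᶻ + l)) *ᶻ fac (k + l)))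
    ≡ (+ 2 *ᶻ + k +ᶻ + 2) *ᶻ (+ 2 *ᶻ + k +ᶻ + 1) *ᶻ fac (k + k) *ᶻ fac (l + l)
  T′-fac = begin
    _ ≡⟨ cong₂ (λ x y → T′ *ᶻ (x *ᶻ fac l *ᶻ y)) (fac-suc k) (fac-suc (k + l)) ⟨
    _ ≡⟨ superCatalan-fac (suc k) l ⟩
    _ ≡⟨ cong (_*ᶻ fac (l + l)) (fac-double-suc k) ⟩
    _ ∎

  expand : ∀ k l K L P T T′ →
    (1ℤ +ᶻ k) *ᶻ ((+ 4 *ᶻ T -ᶻ T′) *ᶻ (K *ᶻ ((1ℤ +ᶻ l) *ᶻ L) *ᶻ ((1ℤ +ᶻ (k +ᶻ l)) *ᶻ P)))
    ≡ + 4 *ᶻ (1ℤ +ᶻ k) *ᶻ (1ℤ +ᶻ l) *ᶻ (1ℤ +ᶻ (k +ᶻ l)) *ᶻ (T *ᶻ (K *ᶻ L *ᶻ P))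
      -ᶻ (1ℤ +ᶻ l) *ᶻ (T′ *ᶻ ((1ℤ +ᶻ k) *ᶻ K *ᶻ L *ᶻ ((1ℤ +ᶻ (k +ᶻ l)) *ᶻ P)))
  expand = solve-∀

  collect : ∀ k l K L →
    + 4 *ᶻ (1ℤ +ᶻ k) *ᶻ (1ℤ +ᶻ l) *ᶻ (1ℤ +ᶻ (k +ᶻ l)) *ᶻ (K *ᶻ L)
      -ᶻ (1ℤ +ᶻ l) *ᶻ ((+ 2 *ᶻ k +ᶻ + 2) *ᶻ (+ 2 *ᶻ k +ᶻ + 1) *ᶻ K *ᶻ L)
    ≡ (1ℤ +ᶻ k) *ᶻ (K *ᶻ ((+ 2 *ᶻ l +ᶻ + 2) *ᶻ (+ 2 *ᶻ l +ᶻ + 1) *ᶻ L))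
  collect = solve-∀

-- Equal to C(k+l,k) C(2k,k) C(2l,l).
t : ℕ → ℕ → ℤ
t k l = + (choose k l * choose k l) *ᶻ superCatalan k l

cube : ℤ → ℤ
cube x = x *ᶻ x *ᶻ x

-- The squared binomial supplies (k+l)!² and the super Catalan number removes one (k+l)!. In this
-- division-free form, identities for `t` follow by cancelling the cube.
t-fac : ∀ k l → t k l *ᶻ cube (fac k *ᶻ fac l) ≡ fac (k + l) *ᶻ fac (k + k) *ᶻ fac (l + l)
t-fac k l = ℤ.*-cancelʳ-≡ _ _ (fac (k + l)) {{fac≢0 (k + l)}} (begin
  + (choose k l * choose k l) *ᶻ T *ᶻ cube (fac k *ᶻ fac l) *ᶻ P
    ≡⟨ cong (λ x → x *ᶻ T *ᶻ cube (fac k *ᶻ fac l) *ᶻ P) (ℤ.pos-* (choose k l) (choose k l)) ⟩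
  B *ᶻ B *ᶻ T *ᶻ cube (fac k *ᶻ fac l) *ᶻ P
    ≡⟨ regroup B T (fac k) (fac l) P ⟩
  B *ᶻ (fac k *ᶻ fac l) *ᶻ (B *ᶻ (fac k *ᶻ fac l)) *ᶻ (T *ᶻ (fac k *ᶻ fac l *ᶻ P))
    ≡⟨ cong₂ (λ x y → x *ᶻ x *ᶻ y) B-fac (superCatalan-fac k l) ⟩
  P *ᶻ P *ᶻ (fac (k + k) *ᶻ fac (l + l))
    ≡⟨ regroup′ P (fac (k + k)) (fac (l + l)) ⟩
  P *ᶻ fac (k + k) *ᶻ fac (l + l) *ᶻ P ∎)
  where
  T B P : ℤ
  T = superCatalan k l
  B = + choose k l
  P = fac (k + l)

  B-fac : B *ᶻ (fac k *ᶻ fac l) ≡ P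
  B-fac = begin
    B *ᶻ (fac k *ᶻ fac l)        ≡⟨ cong (B *ᶻ_) (ℤ.pos-* (k !) (l !)) ⟨
    B *ᶻ + (k ! * l !)           ≡⟨ ℤ.pos-* (choose k l) (k ! * l !) ⟨
    + (choose k l * (k ! * l !)) ≡⟨ cong +_ (choose-! k l) ⟩
    P                            ∎

  regroup : ∀ B T K L P → B *ᶻ B *ᶻ T *ᶻ (K *ᶻ L *ᶻ (K *ᶻ L) *ᶻ (K *ᶻ L)) *ᶻ P
    ≡ B *ᶻ (K *ᶻ L) *ᶻ (B *ᶻ (K *ᶻ L)) *ᶻ (T *ᶻ (K *ᶻ L *ᶻ P))
  regroup = solve-∀

  regroup′ : ∀ P K L → P *ᶻ P *ᶻ (K *ᶻ L) ≡ P *ᶻ K *ᶻ L *ᶻ P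
  regroup′ = solve-∀

cube≢0 : ∀ x → .{{ℤ.NonZero x}} → ℤ.NonZero (cube x)
cube≢0 x = ℤ.i*j≢0 (x *ᶻ x) x {{ℤ.i*j≢0 x x}}

cube-fac≢0 : ∀ k l → ℤ.NonZero (cube (fac k *ᶻ fac l))
cube-fac≢0 k l = cube≢0 (fac k *ᶻ fac l) {{ℤ.i*j≢0 (fac k) (fac l) {{fac≢0 k}} {{fac≢0 l}}}}

t-sym : ∀ k l → t k l ≡ t l k
t-sym k l = ℤ.*-cancelʳ-≡ _ _ _ {{cube-fac≢0 k l}} (begin
  t k l *ᶻ cube (fac k *ᶻ fac l)
    ≡⟨ t-fac k l ⟩
  fac (k + l) *ᶻ fac (k + k) *ᶻ fac (l + l)
    ≡⟨ cong (λ m → fac m *ᶻ fac (k + k) *ᶻ fac (l + l)) (ℕ.+-comm k l) ⟩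
  fac (l + k) *ᶻ fac (k + k) *ᶻ fac (l + l)
    ≡⟨ swap (fac (l + k)) (fac (k + k)) (fac (l + l)) ⟩
  fac (l + k) *ᶻ fac (l + l) *ᶻ fac (k + k)
    ≡⟨ t-fac l k ⟨
  t l k *ᶻ cube (fac l *ᶻ fac k)
    ≡⟨ cong (λ x → t l k *ᶻ cube x) (ℤ.*-comm (fac l) (fac k)) ⟩
  t l k *ᶻ cube (fac k *ᶻ fac l) ∎)
  where
  swap : ∀ a b c → a *ᶻ b *ᶻ c ≡ a *ᶻ c *ᶻ b
  swap = solve-∀

-- The term ratio: the cube yields (k+1)³, of which one factor cancels against 2k + 2. The factor k
-- + l + 1 is constant along the new antidiagonal, so it can leave the sum.
t-suc : ∀ k l → (1ℤ +ᶻ + k) *ᶻ (1ℤ +ᶻ + k) *ᶻ t (suc k) l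
  ≡ (1ℤ +ᶻ (+ k +ᶻ + l)) *ᶻ (+ 4 *ᶻ + k +ᶻ + 2) *ᶻ t k l
t-suc k l = ℤ.*-cancelˡ-≡ (1ℤ +ᶻ + k) _ _ (ℤ.*-cancelʳ-≡ _ _ _ {{cube-fac≢0 k l}} (begin
  _ ≡⟨ split (+ k) (fac k) (fac l) (t (suc k) l) ⟩
  t (suc k) l *ᶻ cube ((1ℤ +ᶻ + k) *ᶻ fac k *ᶻ fac l)
    ≡⟨ cong (λ x → t (suc k) l *ᶻ cube (x *ᶻ fac l)) (fac-suc k) ⟨
  t (suc k) l *ᶻ cube (fac (suc k) *ᶻ fac l)
    ≡⟨ t-fac (suc k) l ⟩
  fac (suc (k + l)) *ᶻ fac (suc k + suc k) *ᶻ fac (l + l)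
    ≡⟨ cong₂ (λ x y → x *ᶻ y *ᶻ fac (l + l)) (fac-suc (k + l)) (fac-double-suc k) ⟩
  _ ≡⟨ join (+ k) (+ l) (fac (k + l)) (fac (k + k)) (fac (l + l)) ⟩
  (1ℤ +ᶻ + k) *ᶻ ((1ℤ +ᶻ (+ k +ᶻ + l)) *ᶻ (+ 4 *ᶻ + k +ᶻ + 2)) *ᶻ (fac (k + l) *ᶻ fac (k + k) *ᶻ fac (l + l))
    ≡⟨ cong ((1ℤ +ᶻ + k) *ᶻ b *ᶻ_) (t-fac k l) ⟨
  _ ≡⟨ assoc₄ (1ℤ +ᶻ + k) b (t k l) (cube (fac k *ᶻ fac l)) ⟩
  _ ∎))
  where
  b : ℤ
  b = (1ℤ +ᶻ (+ k +ᶻ + l)) *ᶻ (+ 4 *ᶻ + k +ᶻ + 2)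

  split : ∀ k K L t → (1ℤ +ᶻ k) *ᶻ ((1ℤ +ᶻ k) *ᶻ (1ℤ +ᶻ k) *ᶻ t) *ᶻ (K *ᶻ L *ᶻ (K *ᶻ L) *ᶻ (K *ᶻ L))
    ≡ t *ᶻ ((1ℤ +ᶻ k) *ᶻ K *ᶻ L *ᶻ ((1ℤ +ᶻ k) *ᶻ K *ᶻ L) *ᶻ ((1ℤ +ᶻ k) *ᶻ K *ᶻ L))
  split = solve-∀

  join : ∀ k l P K L →
    (1ℤ +ᶻ (k +ᶻ l)) *ᶻ P *ᶻ ((+ 2 *ᶻ k +ᶻ + 2) *ᶻ (+ 2 *ᶻ k +ᶻ + 1) *ᶻ K) *ᶻ L
    ≡ (1ℤ +ᶻ k) *ᶻ ((1ℤ +ᶻ (k +ᶻ l)) *ᶻ (+ 4 *ᶻ k +ᶻ + 2)) *ᶻ (P *ᶻ K *ᶻ L)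
  join = solve-∀

  assoc₄ : ∀ a b c d → a *ᶻ b *ᶻ (c *ᶻ d) ≡ a *ᶻ (b *ᶻ c) *ᶻ d
  assoc₄ = solve-∀

-- Moments of the summand and the recurrence

Z : ℕ → ℤ
Z = ∑ t

moment : ℕ → ℕ → ℤ
moment i = ∑ (λ k l → (+ k) ^ᶻ i *ᶻ t k l)

∑-quadratic : ∀ a b c n →
  ∑ (λ k l → (a +ᶻ b *ᶻ + k +ᶻ c *ᶻ (+ k *ᶻ + k)) *ᶻ t k l) n
  ≡ a *ᶻ Z n +ᶻ b *ᶻ moment 1 n +ᶻ c *ᶻ moment 2 n
∑-quadratic a b c n = begin
  _ ≡⟨ ∑-cong n (λ k l _ → expand a b c (+ k) (t k l)) ⟩
  _ ≡⟨ ∑-+ _ _ n ⟩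
  _ ≡⟨ cong₂ _+ᶻ_ (∑-+ _ _ n) (∑-*ˡ c _ n) ⟩
  _ ≡⟨ cong (_+ᶻ c *ᶻ moment 2 n) (cong₂ _+ᶻ_ (∑-*ˡ a _ n) (∑-*ˡ b _ n)) ⟩
  _ ∎
  where
  expand : ∀ a b c k t → (a +ᶻ b *ᶻ k +ᶻ c *ᶻ (k *ᶻ k)) *ᶻ t
    ≡ a *ᶻ t +ᶻ b *ᶻ (k *ᶻ 1ℤ *ᶻ t) +ᶻ c *ᶻ (k *ᶻ (k *ᶻ 1ℤ) *ᶻ t)
  expand = solve-∀

moment-flip : ∀ i n → moment i n ≡ ∑ (λ k l → (+ l) ^ᶻ i *ᶻ t k l) n
moment-flip i n = trans (∑-flip _ n)
  (∑-cong n (λ k l _ → cong ((+ l) ^ᶻ i *ᶻ_) (t-sym l k)))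

-- Averages k with n - k, using the symmetry of `t`.
2*moment₁ : ∀ n → + 2 *ᶻ moment 1 n ≡ + n *ᶻ Z n
2*moment₁ n = begin
  + 2 *ᶻ moment 1 n                             ≡⟨ double (moment 1 n) ⟩
  moment 1 n +ᶻ moment 1 n                      ≡⟨ cong (moment 1 n +ᶻ_) (moment-flip 1 n) ⟩
  moment 1 n +ᶻ ∑ (λ k l → (+ l) ^ᶻ 1 *ᶻ t k l) n ≡⟨ ∑-+ _ _ n ⟨
  _                                             ≡⟨ ∑-cong n pointwise ⟩
  ∑ (λ k l → + n *ᶻ t k l) n                    ≡⟨ ∑-*ˡ (+ n) t n ⟩
  + n *ᶻ Z n                                    ∎
  where
  double : ∀ x → + 2 *ᶻ x ≡ x +ᶻ x
  double = solve-∀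
  factor : ∀ k l t → k *ᶻ 1ℤ *ᶻ t +ᶻ l *ᶻ 1ℤ *ᶻ t ≡ (k +ᶻ l) *ᶻ t
  factor = solve-∀
  pointwise : ∀ k l → k + l ≡ n →
    (+ k) ^ᶻ 1 *ᶻ t k l +ᶻ (+ l) ^ᶻ 1 *ᶻ t k l ≡ + n *ᶻ t k l
  pointwise k l refl = factor (+ k) (+ l) (t k l)

-- k³ + (n - k)³ is quadratic in k.
2*moment₃ : ∀ n → + 2 *ᶻ moment 3 n ≡
  + n *ᶻ + n *ᶻ + n *ᶻ Z n +ᶻ - (+ 3 *ᶻ + n *ᶻ + n) *ᶻ moment 1 n +ᶻ + 3 *ᶻ + n *ᶻ moment 2 n
2*moment₃ n = begin
  + 2 *ᶻ moment 3 n                             ≡⟨ double (moment 3 n) ⟩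
  moment 3 n +ᶻ moment 3 n                      ≡⟨ cong (moment 3 n +ᶻ_) (moment-flip 3 n) ⟩
  moment 3 n +ᶻ ∑ (λ k l → (+ l) ^ᶻ 3 *ᶻ t k l) n ≡⟨ ∑-+ _ _ n ⟨
  _                                             ≡⟨ ∑-cong n pointwise ⟩
  _                                             ≡⟨ ∑-quadratic (+ n *ᶻ + n *ᶻ + n) (- (+ 3 *ᶻ + n *ᶻ + n)) (+ 3 *ᶻ + n) n ⟩
  _                                             ∎
  where
  double : ∀ x → + 2 *ᶻ x ≡ x +ᶻ x
  double = solve-∀
  factor : ∀ k l t → k *ᶻ (k *ᶻ (k *ᶻ 1ℤ)) *ᶻ t +ᶻ l *ᶻ (l *ᶻ (l *ᶻ 1ℤ)) *ᶻ t
    ≡ ((k +ᶻ l) *ᶻ (k +ᶻ l) *ᶻ (k +ᶻ l) +ᶻ - (+ 3 *ᶻ (k +ᶻ l) *ᶻ (k +ᶻ l)) *ᶻ k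
        +ᶻ + 3 *ᶻ (k +ᶻ l) *ᶻ (k *ᶻ k)) *ᶻ t
  factor = solve-∀
  pointwise : ∀ k l → k + l ≡ n → (+ k) ^ᶻ 3 *ᶻ t k l +ᶻ (+ l) ^ᶻ 3 *ᶻ t k l
    ≡ (+ n *ᶻ + n *ᶻ + n +ᶻ - (+ 3 *ᶻ + n *ᶻ + n) *ᶻ + k +ᶻ + 3 *ᶻ + n *ᶻ (+ k *ᶻ + k)) *ᶻ t k l
  pointwise k l refl = factor (+ k) (+ l) (t k l)

-- Two of the powers of the index clear the denominator in `t-suc`, and they also make the term with
-- k = 0 vanish, so the sum shifts down to `n`.
moment-suc : ∀ i n → moment (suc (suc i)) (suc n) ≡
  (1ℤ +ᶻ + n) *ᶻ ∑ (λ k l → (1ℤ +ᶻ + k) ^ᶻ i *ᶻ (+ 4 *ᶻ + k +ᶻ + 2) *ᶻ t k l) n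
moment-suc i n = begin
  0ℤ +ᶻ ∑ (λ k l → (+ suc k) ^ᶻ suc (suc i) *ᶻ t (suc k) l) n
    ≡⟨ ℤ.+-identityˡ _ ⟩
  ∑ (λ k l → (+ suc k) ^ᶻ suc (suc i) *ᶻ t (suc k) l) n
    ≡⟨ ∑-cong n pointwise ⟩
  _
    ≡⟨ ∑-*ˡ (1ℤ +ᶻ + n) _ n ⟩
  _ ∎
  where
  regroup : ∀ a g t → a *ᶻ (a *ᶻ g) *ᶻ t ≡ g *ᶻ (a *ᶻ a *ᶻ t)
  regroup = solve-∀
  regroup′ : ∀ a b g t → g *ᶻ (a *ᶻ b *ᶻ t) ≡ a *ᶻ (g *ᶻ b *ᶻ t)
  regroup′ = solve-∀
  pointwise : ∀ k l → k + l ≡ n → (+ suc k) ^ᶻ suc (suc i) *ᶻ t (suc k) l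
    ≡ (1ℤ +ᶻ + n) *ᶻ ((1ℤ +ᶻ + k) ^ᶻ i *ᶻ (+ 4 *ᶻ + k +ᶻ + 2) *ᶻ t k l)
  pointwise k l refl = begin
    _ ≡⟨ regroup (1ℤ +ᶻ + k) ((1ℤ +ᶻ + k) ^ᶻ i) (t (suc k) l) ⟩
    _ ≡⟨ cong ((1ℤ +ᶻ + k) ^ᶻ i *ᶻ_) (t-suc k l) ⟩
    _ ≡⟨ regroup′ (1ℤ +ᶻ + n) (+ 4 *ᶻ + k +ᶻ + 2) ((1ℤ +ᶻ + k) ^ᶻ i) (t k l) ⟩
    _ ∎

moment₂-suc : ∀ n → moment 2 (suc n) ≡ + 2 *ᶻ (1ℤ +ᶻ + n) *ᶻ (1ℤ +ᶻ + n) *ᶻ Z n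
moment₂-suc n = begin
  _ ≡⟨ moment-suc 0 n ⟩
  _ ≡⟨ cong ((1ℤ +ᶻ + n) *ᶻ_) (∑-cong n (λ k l _ → pad (+ k) (t k l))) ⟩
  _ ≡⟨ cong ((1ℤ +ᶻ + n) *ᶻ_) (∑-quadratic (+ 2) (+ 4) 0ℤ n) ⟩
  _ ≡⟨ regroup (+ n) (Z n) (moment 1 n) (moment 2 n) ⟩
  (1ℤ +ᶻ + n) *ᶻ (+ 2 *ᶻ Z n +ᶻ + 2 *ᶻ (+ 2 *ᶻ moment 1 n))
    ≡⟨ cong (λ x → (1ℤ +ᶻ + n) *ᶻ (+ 2 *ᶻ Z n +ᶻ + 2 *ᶻ x)) (2*moment₁ n) ⟩
  _ ≡⟨ regroup′ (+ n) (Z n) ⟩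
  _ ∎
  where
  pad : ∀ k t → 1ℤ *ᶻ (+ 4 *ᶻ k +ᶻ + 2) *ᶻ t ≡ (+ 2 +ᶻ + 4 *ᶻ k +ᶻ 0ℤ *ᶻ (k *ᶻ k)) *ᶻ t
  pad = solve-∀
  regroup : ∀ n z x y → (1ℤ +ᶻ n) *ᶻ (+ 2 *ᶻ z +ᶻ + 4 *ᶻ x +ᶻ 0ℤ *ᶻ y)
    ≡ (1ℤ +ᶻ n) *ᶻ (+ 2 *ᶻ z +ᶻ + 2 *ᶻ (+ 2 *ᶻ x))
  regroup = solve-∀
  regroup′ : ∀ n z → (1ℤ +ᶻ n) *ᶻ (+ 2 *ᶻ z +ᶻ + 2 *ᶻ (n *ᶻ z)) ≡ + 2 *ᶻ (1ℤ +ᶻ n) *ᶻ (1ℤ +ᶻ n) *ᶻ z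
  regroup′ = solve-∀

moment₃-suc : ∀ n → moment 3 (suc n) ≡
  (1ℤ +ᶻ + n) *ᶻ (+ 2 *ᶻ Z n +ᶻ + 6 *ᶻ moment 1 n +ᶻ + 4 *ᶻ moment 2 n)
moment₃-suc n = begin
  _ ≡⟨ moment-suc 1 n ⟩
  _ ≡⟨ cong ((1ℤ +ᶻ + n) *ᶻ_) (∑-cong n (λ k l _ → expand (+ k) (t k l))) ⟩
  _ ≡⟨ cong ((1ℤ +ᶻ + n) *ᶻ_) (∑-quadratic (+ 2) (+ 6) (+ 4) n) ⟩
  _ ∎
  where
  expand : ∀ k t → (1ℤ +ᶻ k) *ᶻ 1ℤ *ᶻ (+ 4 *ᶻ k +ᶻ + 2) *ᶻ t
    ≡ (+ 2 +ᶻ + 6 *ᶻ k +ᶻ + 4 *ᶻ (k *ᶻ k)) *ᶻ t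
  expand = solve-∀

-- The third moment at n + 2 is evaluated twice: by the reflection symmetry at the same index, and
-- by the term ratio at index n + 1. Comparing the two gives the recurrence, up to a common factor
-- `N`.
Z-rec : ∀ n → let N = 1ℤ +ᶻ + suc n in
  N *ᶻ N *ᶻ Z (suc (suc n)) ≡
    + 4 *ᶻ (+ 3 *ᶻ (+ suc n *ᶻ + suc n) +ᶻ + 3 *ᶻ + suc n +ᶻ 1ℤ) *ᶻ Z (suc n)
      -ᶻ + 32 *ᶻ (+ suc n *ᶻ + suc n) *ᶻ Z n
Z-rec n = ℤ.*-cancelˡ-≡ N _ _ (begin
  N *ᶻ (N *ᶻ N *ᶻ a)
    -- Symmetry, with moment 1 equal to N a / 2 and moment 2 equal to 2 N² b, gives 4 · moment 3 =
    -- 12 N³ b - N³ a. The right side is arranged so that these values can be substituted backwards.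
    ≡⟨ step₁ N a b ⟩
  + 12 *ᶻ N *ᶻ N *ᶻ N *ᶻ b -ᶻ (+ 2 *ᶻ N *ᶻ N *ᶻ N *ᶻ a -ᶻ + 3 *ᶻ N *ᶻ N *ᶻ (N *ᶻ a)
    +ᶻ + 6 *ᶻ N *ᶻ (+ 2 *ᶻ N *ᶻ N *ᶻ b))
    ≡⟨ cong₂ (λ x y → + 12 *ᶻ N *ᶻ N *ᶻ N *ᶻ b -ᶻ (+ 2 *ᶻ N *ᶻ N *ᶻ N *ᶻ a
         -ᶻ + 3 *ᶻ N *ᶻ N *ᶻ x +ᶻ + 6 *ᶻ N *ᶻ y))
         (2*moment₁ (suc (suc n))) (moment₂-suc (suc n)) ⟨
  _ ≡⟨ step₂ N a b (moment 1 (suc (suc n))) (moment 2 (suc (suc n))) ⟩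
  _ ≡⟨ cong (λ x → + 12 *ᶻ N *ᶻ N *ᶻ N *ᶻ b -ᶻ + 2 *ᶻ x) (2*moment₃ (suc (suc n))) ⟨
  + 12 *ᶻ N *ᶻ N *ᶻ N *ᶻ b -ᶻ + 2 *ᶻ (+ 2 *ᶻ moment 3 (suc (suc n)))
    ≡⟨ cong (λ x → + 12 *ᶻ N *ᶻ N *ᶻ N *ᶻ b -ᶻ + 2 *ᶻ (+ 2 *ᶻ x)) (moment₃-suc (suc n)) ⟩
  _ ≡⟨ step₃ N b (moment 1 (suc n)) (moment 2 (suc n)) ⟩
  + 12 *ᶻ N *ᶻ N *ᶻ N *ᶻ b
    -ᶻ + 4 *ᶻ N *ᶻ (+ 2 *ᶻ b +ᶻ + 3 *ᶻ (+ 2 *ᶻ moment 1 (suc n)) +ᶻ + 4 *ᶻ moment 2 (suc n))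
    ≡⟨ cong₂ (λ x y → + 12 *ᶻ N *ᶻ N *ᶻ N *ᶻ b
         -ᶻ + 4 *ᶻ N *ᶻ (+ 2 *ᶻ b +ᶻ + 3 *ᶻ x +ᶻ + 4 *ᶻ y))
         (2*moment₁ (suc n)) (moment₂-suc n) ⟩
  _ ≡⟨ step₄ (+ suc n) b c ⟩
  _ ∎)
  where
  N a b c : ℤ
  N = 1ℤ +ᶻ + suc n
  a = Z (suc (suc n))
  b = Z (suc n)
  c = Z n

  step₁ : ∀ N a b → N *ᶻ (N *ᶻ N *ᶻ a) ≡
    + 12 *ᶻ N *ᶻ N *ᶻ N *ᶻ b -ᶻ (+ 2 *ᶻ N *ᶻ N *ᶻ N *ᶻ a -ᶻ + 3 *ᶻ N *ᶻ N *ᶻ (N *ᶻ a)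
      +ᶻ + 6 *ᶻ N *ᶻ (+ 2 *ᶻ N *ᶻ N *ᶻ b))
  step₁ = solve-∀

  step₂ : ∀ N a b x y →
    + 12 *ᶻ N *ᶻ N *ᶻ N *ᶻ b -ᶻ (+ 2 *ᶻ N *ᶻ N *ᶻ N *ᶻ a
      -ᶻ + 3 *ᶻ N *ᶻ N *ᶻ (+ 2 *ᶻ x) +ᶻ + 6 *ᶻ N *ᶻ y)
    ≡ + 12 *ᶻ N *ᶻ N *ᶻ N *ᶻ b
      -ᶻ + 2 *ᶻ (N *ᶻ N *ᶻ N *ᶻ a +ᶻ - (+ 3 *ᶻ N *ᶻ N) *ᶻ x +ᶻ + 3 *ᶻ N *ᶻ y)
  step₂ = solve-∀

  step₃ : ∀ N b x y →
    + 12 *ᶻ N *ᶻ N *ᶻ N *ᶻ b -ᶻ + 2 *ᶻ (+ 2 *ᶻ (N *ᶻ (+ 2 *ᶻ b +ᶻ + 6 *ᶻ x +ᶻ + 4 *ᶻ y)))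
    ≡ + 12 *ᶻ N *ᶻ N *ᶻ N *ᶻ b
      -ᶻ + 4 *ᶻ N *ᶻ (+ 2 *ᶻ b +ᶻ + 3 *ᶻ (+ 2 *ᶻ x) +ᶻ + 4 *ᶻ y)
  step₃ = solve-∀

  step₄ : ∀ n b c →
    + 12 *ᶻ (1ℤ +ᶻ n) *ᶻ (1ℤ +ᶻ n) *ᶻ (1ℤ +ᶻ n) *ᶻ b
      -ᶻ + 4 *ᶻ (1ℤ +ᶻ n) *ᶻ (+ 2 *ᶻ b +ᶻ + 3 *ᶻ (n *ᶻ b) +ᶻ + 4 *ᶻ (+ 2 *ᶻ n *ᶻ n *ᶻ c))
    ≡ (1ℤ +ᶻ n) *ᶻ (+ 4 *ᶻ (+ 3 *ᶻ (n *ᶻ n) +ᶻ + 3 *ᶻ n +ᶻ 1ℤ) *ᶻ b -ᶻ + 32 *ᶻ (n *ᶻ n) *ᶻ c)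
  step₄ = solve-∀

-- Identification of the recurrence sequence with the sum

module Recurrence {S : ℕ → ℤ} (isS : IsS S) where
  open IsS isS

  S-rec′ : ∀ n → let N = 1ℤ +ᶻ + suc n in
    N *ᶻ N *ᶻ S (suc (suc n)) ≡
      + 4 *ᶻ (+ 3 *ᶻ (+ suc n *ᶻ + suc n) +ᶻ + 3 *ᶻ + suc n +ᶻ 1ℤ) *ᶻ S (suc n)
        -ᶻ + 32 *ᶻ (+ suc n *ᶻ + suc n) *ᶻ S n
  S-rec′ n = begin
    _ ≡⟨ cong (λ m → (1ℤ +ᶻ + suc n) *ᶻ (1ℤ +ᶻ + suc n) *ᶻ S m) (ℕ.+-comm 1 (suc n)) ⟩
    _ ≡⟨ lhs (+ suc n) (S (suc n + 1)) ⟩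
    _ ≡⟨ S-rec (suc n) (s≤s z≤n) ⟩
    _ ≡⟨ rhs (+ suc n) (S (suc n)) (S n) ⟩
    _ ∎
    where
    lhs : ∀ n x → (1ℤ +ᶻ n) *ᶻ (1ℤ +ᶻ n) *ᶻ x ≡ (n +ᶻ 1ℤ) *ᶻ ((n +ᶻ 1ℤ) *ᶻ 1ℤ) *ᶻ x
    lhs = solve-∀
    rhs : ∀ n x y →
      + 4 *ᶻ (+ 3 *ᶻ (n *ᶻ (n *ᶻ 1ℤ)) +ᶻ + 3 *ᶻ n +ᶻ 1ℤ) *ᶻ x -ᶻ + 32 *ᶻ (n *ᶻ (n *ᶻ 1ℤ)) *ᶻ y
      ≡ + 4 *ᶻ (+ 3 *ᶻ (n *ᶻ n) +ᶻ + 3 *ᶻ n +ᶻ 1ℤ) *ᶻ x -ᶻ + 32 *ᶻ (n *ᶻ n) *ᶻ y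
    rhs = solve-∀

  -- The recurrence has order two, so the induction carries two consecutive values.
  S≡Z-pair : ∀ n → S n ≡ Z n × S (suc n) ≡ Z (suc n)
  S≡Z-pair zero    = S-zero , S-one
  S≡Z-pair (suc n) with S≡Z-pair n
  ... | eq₀ , eq₁ = eq₁ , ℤ.*-cancelˡ-≡ (N *ᶻ N) _ _ {{ℤ.i*j≢0 N N}} (begin
    N *ᶻ N *ᶻ S (suc (suc n)) ≡⟨ S-rec′ n ⟩
    _                         ≡⟨ cong₂ (λ x y → + 4 *ᶻ (+ 3 *ᶻ (+ suc n *ᶻ + suc n) +ᶻ + 3 *ᶻ + suc n +ᶻ 1ℤ) *ᶻ x
                                   -ᶻ + 32 *ᶻ (+ suc n *ᶻ + suc n) *ᶻ y) eq₁ eq₀ ⟩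
    _                         ≡⟨ Z-rec n ⟨
    N *ᶻ N *ᶻ Z (suc (suc n)) ∎)
    where
    N : ℤ
    N = 1ℤ +ᶻ + suc n

  S≡Z : ∀ n → S n ≡ Z n
  S≡Z = proj₁ ∘ S≡Z-pair

-- Congruences and prime powers

mod-refl : ∀ {d} a → a ≡ a [mod d ]
mod-refl a = divides 0ℤ (ℤ.+-inverseʳ a)

mod-reflexive : ∀ {d a b} → a ≡ b → a ≡ b [mod d ]
mod-reflexive {a = a} refl = mod-refl a

mod-trans : ∀ {d} a b c → a ≡ b [mod d ] → b ≡ c [mod d ] → a ≡ c [mod d ]
mod-trans {d} a b c h₁ h₂ = subst (d ∣ᶻ_) (identity a b c) (ℤ.∣m∣n⇒∣m+n h₁ h₂)
  where
  identity : ∀ a b c → (a -ᶻ b) +ᶻ (b -ᶻ c) ≡ a -ᶻ c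
  identity = solve-∀

mod-+ : ∀ {d} a b a′ b′ → a ≡ b [mod d ] → a′ ≡ b′ [mod d ] → a +ᶻ a′ ≡ b +ᶻ b′ [mod d ]
mod-+ {d} a b a′ b′ h h′ = subst (d ∣ᶻ_) (identity a b a′ b′) (ℤ.∣m∣n⇒∣m+n h h′)
  where
  identity : ∀ a b a′ b′ → (a -ᶻ b) +ᶻ (a′ -ᶻ b′) ≡ (a +ᶻ a′) -ᶻ (b +ᶻ b′)
  identity = solve-∀

mod-* : ∀ {d} a b a′ b′ → a ≡ b [mod d ] → a′ ≡ b′ [mod d ] → a *ᶻ a′ ≡ b *ᶻ b′ [mod d ]
mod-* {d} a b a′ b′ h h′ = subst (d ∣ᶻ_) (identity a b a′ b′)
  (ℤ.∣m∣n⇒∣m+n (ℤ.∣m⇒∣m*n a′ h) (ℤ.∣n⇒∣m*n b h′))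
  where
  identity : ∀ a b a′ b′ → (a -ᶻ b) *ᶻ a′ +ᶻ b *ᶻ (a′ -ᶻ b′) ≡ a *ᶻ a′ -ᶻ b *ᶻ b′
  identity = solve-∀

∣-*-mono : ∀ {a b x y} → a ∣ᶻ x → b ∣ᶻ y → a *ᶻ b ∣ᶻ x *ᶻ y
∣-*-mono {a} {b} (divides q refl) (divides r refl) = divides (q *ᶻ r) (identity q a r b)
  where
  identity : ∀ q a r b → q *ᶻ a *ᶻ (r *ᶻ b) ≡ q *ᶻ r *ᶻ (a *ᶻ b)
  identity = solve-∀

∑-mod : ∀ {d f g} n → (∀ k l → k + l ≡ n → f k l ≡ g k l [mod d ]) → ∑ f n ≡ ∑ g n [mod d ]
∑-mod {d} = ∑-rel (_≡_[mod d ]) (λ {a} {b} {c} {e} → mod-+ a b c e)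

∏-mod : ∀ {d f g} n → (∀ k l → k + l ≡ n → f k l ≡ g k l [mod d ]) → ∏ f n ≡ ∏ g n [mod d ]
∏-mod {d} = ∏-rel (_≡_[mod d ]) (λ {a} {b} {c} {e} → mod-* a b c e)

∑-drop : ∀ {d} f q n → (∀ k l → k < q → k + l ≡ q + n → d ∣ᶻ f k l) →
  ∑ f (q + n) ≡ ∑ (λ k l → f (q + k) l) n [mod d ]
∑-drop f zero    n h = mod-refl (∑ f n)
∑-drop {d} f (suc q) n h = mod-trans
  (f 0 (suc q + n) +ᶻ ∑ f′ (q + n)) (∑ f′ (q + n)) (∑ (λ k l → f (suc q + k) l) n)
  (subst (d ∣ᶻ_) (identity (f 0 (suc q + n)) (∑ f′ (q + n))) (h 0 (suc q + n) (s≤s z≤n) refl))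
  (∑-drop f′ q n (λ k l k<q eq → h (suc k) l (s≤s k<q) (cong suc eq)))
  where
  f′ : ℕ → ℕ → ℤ
  f′ k l = f (suc k) l
  identity : ∀ a b → a ≡ a +ᶻ b -ᶻ b
  identity = solve-∀

-- Removes p consecutive indices at a time: the first is a multiple of p and stays, the other `q`
-- lie strictly between multiples and go by `∑-drop`.
∑-multiples : ∀ {d} q f n → let p = suc q in
  (∀ k l → k + l ≡ n * p → ¬ p ∣ k → d ∣ᶻ f k l) →
  ∑ f (n * p) ≡ ∑ (λ k l → f (k * p) (l * p)) n [mod d ]
∑-multiples q f zero    h = mod-refl (f 0 0)
∑-multiples {d} q f (suc n) h = mod-+
  (f 0 (suc n * p)) (f 0 (suc n * p))
  (∑ (λ k l → f (suc k) l) (q + n * p)) (∑ (λ k l → f (suc k * p) (l * p)) n)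
  (mod-refl (f 0 (suc n * p))) (mod-trans
  (∑ (λ k l → f (suc k) l) (q + n * p))
  (∑ (λ k l → f (p + k) l) (n * p))
  (∑ (λ k l → f (suc k * p) (l * p)) n)
  (∑-drop (λ k l → f (suc k) l) q (n * p)
    (λ k l k<q eq → h (suc k) l (cong suc eq) (ℕ.>⇒∤ (s≤s k<q))))
  (∑-multiples q (λ k l → f (p + k) l) n
    (λ k l eq p∤k → h (p + k) l (trans (ℕ.+-assoc p k l) (cong (λ m → p + m) eq))
      (λ p∣p+k → p∤k (ℕ.∣m+n∣m⇒∣n p∣p+k ℕ.∣-refl)))))
  where
  p : ℕ
  p = suc q

-- Prime valuations and divisibility of the summand

module PrimePowers {p : ℕ} (p-prime : Prime p) where

  private instance
    p≢0 : NonZero p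
    p≢0 = prime⇒nonZero p-prime

  euclid : ∀ a b → + p ∣ᶻ a *ᶻ b → (+ p ∣ᶻ a) ⊎ (+ p ∣ᶻ b)
  euclid a b h with euclidsLemma ℤ.∣ a ∣ ℤ.∣ b ∣ p-prime (subst (p ∣_) (ℤ.abs-* a b) (ℤ.∣⇒∣ᵤ h))
  ... | inj₁ p∣a = inj₁ (ℤ.∣ᵤ⇒∣ p∣a)
  ... | inj₂ p∣b = inj₂ (ℤ.∣ᵤ⇒∣ p∣b)

  ∤-* : ∀ {a b} → ¬ + p ∣ᶻ a → ¬ + p ∣ᶻ b → ¬ + p ∣ᶻ a *ᶻ b
  ∤-* {a} {b} p∤a p∤b = [ p∤a , p∤b ]′ ∘ euclid a b

  ∤-cube : ∀ {a} → ¬ + p ∣ᶻ a → ¬ + p ∣ᶻ cube a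
  ∤-cube {a} p∤a = ∤-* {a *ᶻ a} {a} (∤-* {a} {a} p∤a p∤a) p∤a

  ∏-∤ : ∀ {f} n → (∀ k l → k + l ≡ n → ¬ + p ∣ᶻ f k l) → ¬ + p ∣ᶻ ∏ f n
  ∏-∤ {f} n = ∏-rel (λ a _ → ¬ + p ∣ᶻ a) (λ {a} {_} {c} → ∤-* {a} {c}) {f} {f} n

  infix 9 p^_
  p^_ : ℕ → ℤ
  p^ j = + (p ^ j)

  p^-+ : ∀ i j → p^ (i + j) ≡ p^ i *ᶻ p^ j
  p^-+ i j = trans (cong +_ (ℕ.^-distribˡ-+-* p i j)) (ℤ.pos-* (p ^ i) (p ^ j))

  p^-suc-∣ : ∀ {x} j → p^ (suc j) ∣ᶻ x → + p ∣ᶻ x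
  p^-suc-∣ j h = ℤ.∣-trans (ℤ.∣ᵤ⇒∣ (ℕ.m∣m*n (p ^ j))) h

  -- Induction on `j`: Euclid's lemma finds one factor p in `x`, which is then cancelled on both
  -- sides.
  ∣-coprime-cancel : ∀ u x j → ¬ p ∣ u → p ^ j ∣ u * x → p ^ j ∣ x
  ∣-coprime-cancel u x zero    p∤u h = ℕ.1∣ x
  ∣-coprime-cancel u x (suc j) p∤u h
    with euclidsLemma u x p-prime (ℕ.∣-trans (ℕ.m∣m*n (p ^ j)) h)
  ... | inj₁ p∣u = ⊥-elim (p∤u p∣u)
  ... | inj₂ (ℕ.divides-refl y) = subst (p ^ suc j ∣_) (ℕ.*-comm p y)
    (ℕ.*-monoʳ-∣ p (∣-coprime-cancel u y j p∤u (ℕ.*-cancelˡ-∣ p (subst (p * p ^ j ∣_) swap h))))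
    where
    swap : u * (y * p) ≡ p * (u * y)
    swap = trans (sym (ℕ.*-assoc u y p)) (ℕ.*-comm (u * y) p)

  ∣ᶻ-coprime-cancel : ∀ u x j → ¬ + p ∣ᶻ u → p^ j ∣ᶻ u *ᶻ x → p^ j ∣ᶻ x
  ∣ᶻ-coprime-cancel u x j p∤u h = ℤ.∣ᵤ⇒∣ (∣-coprime-cancel ℤ.∣ u ∣ ℤ.∣ x ∣ j
    (p∤u ∘ ℤ.∣ᵤ⇒∣) (subst (p ^ j ∣_) (ℤ.abs-* u x) (ℤ.∣⇒∣ᵤ h)))

  -- The valuation is cut off at `r`, which covers k = 0 as well. In the second case `s` is exact
  -- and `suc j` records that s < r.
  ^∣⊎valuation : ∀ r k → (p ^ r ∣ k) ⊎
    (∃[ s ] ∃[ j ] ∃[ u ] (s + suc j ≡ r × k ≡ u * p ^ s × ¬ p ∣ u))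
  ^∣⊎valuation zero    k = inj₁ (ℕ.1∣ k)
  ^∣⊎valuation (suc r) k with ^∣⊎valuation r k
  ... | inj₂ (s , j , u , refl , k≡ , p∤u) = inj₂ (s , suc j , u , ℕ.+-suc s (suc j) , k≡ , p∤u)
  ... | inj₁ (ℕ.divides u k≡) with p ℕ.∣? u
  ...   | yes p∣u = inj₁ (subst (p ^ suc r ∣_) (sym k≡) (ℕ.*-monoˡ-∣ (p ^ r) p∣u))
  ...   | no  p∤u = inj₂ (r , 0 , u , ℕ.+-comm r 1 , k≡ , p∤u)

  -- Here `s` is the valuation of k capped at `r`. If s < r, absorption leaves p^(r-s) dividing u
  -- times the coefficient with `u` prime to p; otherwise j = 0 and nothing is claimed of the
  -- coefficient.
  choose-∣ : ∀ r k l → p ^ r ∣ k + l →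
    ∃[ s ] ∃[ j ] (s + j ≡ r × p ^ s ∣ k × p ^ j ∣ choose k l)
  choose-∣ r zero    l h = r , 0 , ℕ.+-identityʳ r , (p ^ r) ℕ.∣0 , ℕ.1∣ _
  choose-∣ r (suc k) l h with ^∣⊎valuation r (suc k)
  ... | inj₁ p^r∣k = r , 0 , ℕ.+-identityʳ r , p^r∣k , ℕ.1∣ _
  ... | inj₂ (s , j , u , refl , k≡ , p∤u) =
    s , suc j , refl , ℕ.divides u k≡ ,
    ∣-coprime-cancel u (choose (suc k) l) (suc j) p∤u
      (ℕ.*-cancelˡ-∣ (p ^ s) {{ℕ.m^n≢0 p s}} (subst₂ _∣_ (ℕ.^-distribˡ-+-* p s (suc j)) absorbed
        (ℕ.∣m⇒∣m*n (choose k l) h)))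
    where
    absorbed : suc (k + l) * choose k l ≡ p ^ s * (u * choose (suc k) l)
    absorbed = begin
      suc (k + l) * choose k l        ≡⟨ choose-absorption k l ⟨
      suc k * choose (suc k) l        ≡⟨ cong (_* choose (suc k) l) (trans k≡ (ℕ.*-comm u (p ^ s))) ⟩
      p ^ s * u * choose (suc k) l    ≡⟨ ℕ.*-assoc (p ^ s) u (choose (suc k) l) ⟩
      p ^ s * (u * choose (suc k) l)  ∎

  t-∣ : ∀ r k l → p ^ r ∣ k + l →
    ∃[ s ] ∃[ j ] (s + j ≡ r × p ^ s ∣ k × p^ (j + j) ∣ᶻ t k l)
  t-∣ r k l h with choose-∣ r k l h
  ... | s , j , eq , p^s∣k , p^j∣c = s , j , eq , p^s∣k ,
    ℤ.∣m⇒∣m*n {m = + (choose k l * choose k l)} (superCatalan k l) (ℤ.∣ᵤ⇒∣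
      (subst (_∣ choose k l * choose k l) (sym (ℕ.^-distribˡ-+-* p j j)) (ℕ.*-pres-∣ p^j∣c p^j∣c)))

  -- As p does not divide k, the exponent `s` must be 0, so the squared binomial carries the full
  -- p^(2r).
  t-∣-coprime : ∀ r k l → p ^ r ∣ k + l → ¬ p ∣ k → p^ (r + r) ∣ᶻ t k l
  t-∣-coprime r k l h p∤k with t-∣ r k l h
  ... | zero  , .r , refl , _     , p^2r∣t = p^2r∣t
  ... | suc s , _  , _    , p^s∣k , _      = ⊥-elim (p∤k (ℕ.∣-trans (ℕ.m∣m*n (p ^ s)) p^s∣k))

-- The p-free part of (pn)! and its congruences

module OddPrime {q : ℕ} (p-prime : Prime (suc (suc q))) (p-odd : ¬ 2 ∣ suc (suc q)) where

  p : ℕ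
  p = suc (suc q)

  open PrimePowers p-prime

  -- (x + 1) ⋯ (x + p − 1)
  block : ℤ → ℤ
  block x = ∏ (λ j _ → x +ᶻ (1ℤ +ᶻ + j)) q

  -- The product of the integers up to n p that are prime to p. Each `block` folds over the
  -- antidiagonal of `q`, hence has q + 1 = p - 1 factors.
  F : ℕ → ℤ
  F zero    = 1ℤ
  F (suc n) = F n *ᶻ block (+ (n * p))

  fac-rising : ∀ m j → fac m *ᶻ ∏ (λ i _ → + m +ᶻ (1ℤ +ᶻ + i)) j ≡ fac (suc j + m)
  fac-rising m zero = begin
    fac m *ᶻ + (m + 1)      ≡⟨ cong (λ i → fac m *ᶻ + i) (ℕ.+-comm m 1) ⟩
    fac m *ᶻ + suc m        ≡⟨ ℤ.*-comm (fac m) (+ suc m) ⟩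
    + suc m *ᶻ fac m        ≡⟨ fac-suc m ⟨
    fac (suc m)             ∎
  fac-rising m (suc j) = begin
    fac m *ᶻ ∏ f (suc j)                ≡⟨ cong (fac m *ᶻ_) (∏-last f j) ⟩
    fac m *ᶻ (∏ f j *ᶻ + (m + (2 + j))) ≡⟨ ℤ.*-assoc (fac m) (∏ f j) _ ⟨
    fac m *ᶻ ∏ f j *ᶻ + (m + (2 + j))   ≡⟨ cong₂ (λ x y → x *ᶻ + y) (fac-rising m j) (ℕ.+-comm m (2 + j)) ⟩
    fac (suc j + m) *ᶻ + (2 + j + m)    ≡⟨ ℤ.*-comm (fac (suc j + m)) (+ (2 + j + m)) ⟩
    + (2 + j + m) *ᶻ fac (suc j + m)    ≡⟨ fac-suc (suc j + m) ⟨
    fac (2 + j + m)                     ∎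
    where
    f : ℕ → ℕ → ℤ
    f i _ = + m +ᶻ (1ℤ +ᶻ + i)

  fac-F : ∀ n → fac (n * p) ≡ p^ n *ᶻ fac n *ᶻ F n
  fac-F zero    = refl
  fac-F (suc n) = begin
    fac (p + n * p)
      ≡⟨ fac-suc (suc q + n * p) ⟩
    + (suc n * p) *ᶻ fac (suc q + n * p)
      ≡⟨ cong₂ _*ᶻ_ (ℤ.pos-* (suc n) p) (sym (fac-rising (n * p) q)) ⟩
    + suc n *ᶻ + p *ᶻ (fac (n * p) *ᶻ block (+ (n * p)))
      ≡⟨ cong (λ x → + suc n *ᶻ + p *ᶻ (x *ᶻ block (+ (n * p)))) (fac-F n) ⟩
    + suc n *ᶻ + p *ᶻ (p^ n *ᶻ fac n *ᶻ F n *ᶻ block (+ (n * p)))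
      ≡⟨ regroup (+ suc n) (+ p) (p^ n) (fac n) (F n) (block (+ (n * p))) ⟩
    + p *ᶻ p^ n *ᶻ (+ suc n *ᶻ fac n) *ᶻ (F n *ᶻ block (+ (n * p)))
      ≡⟨ cong₂ (λ x y → x *ᶻ y *ᶻ F (suc n)) (ℤ.pos-* p (p ^ n)) (fac-suc n) ⟨
    p^ suc n *ᶻ fac (suc n) *ᶻ F (suc n) ∎
    where
    regroup : ∀ n p x y z w → n *ᶻ p *ᶻ (x *ᶻ y *ᶻ z *ᶻ w) ≡ p *ᶻ x *ᶻ (n *ᶻ y) *ᶻ (z *ᶻ w)
    regroup = solve-∀

  -- By `fac-F` each side of the factorial formula gains the same power p^(3(k+l)), which cancels
  -- and leaves only values of `F`.
  t-multiple : ∀ k l → t (k * p) (l * p) *ᶻ cube (F k *ᶻ F l)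
    ≡ t k l *ᶻ (F (k + l) *ᶻ F (k + k) *ᶻ F (l + l))
  t-multiple k l = ℤ.*-cancelʳ-≡ _ _ (cube (A *ᶻ B *ᶻ (K *ᶻ L))) {{nonZero}} (begin
    t′ *ᶻ cube (F k *ᶻ F l) *ᶻ cube (A *ᶻ B *ᶻ (K *ᶻ L))
      ≡⟨ collect t′ A B K L (F k) (F l) ⟩
    t′ *ᶻ cube (A *ᶻ K *ᶻ F k *ᶻ (B *ᶻ L *ᶻ F l))
      ≡⟨ cong₂ (λ x y → t′ *ᶻ cube (x *ᶻ y)) (fac-F k) (fac-F l) ⟨
    t′ *ᶻ cube (fac (k * p) *ᶻ fac (l * p))
      ≡⟨ t-fac (k * p) (l * p) ⟩
    fac (k * p + l * p) *ᶻ fac (k * p + k * p) *ᶻ fac (l * p + l * p)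
      ≡⟨ cong₂ _*ᶻ_ (cong₂ _*ᶻ_ (fac-F-+ k l) (fac-F-+ k k)) (fac-F-+ l l) ⟩
    _ ≡⟨ regroup A B (fac (k + l)) (fac (k + k)) (fac (l + l)) (F (k + l)) (F (k + k)) (F (l + l)) ⟩
    fac (k + l) *ᶻ fac (k + k) *ᶻ fac (l + l) *ᶻ G *ᶻ cube (A *ᶻ B)
      ≡⟨ cong (λ x → x *ᶻ G *ᶻ cube (A *ᶻ B)) (t-fac k l) ⟨
    t k l *ᶻ cube (K *ᶻ L) *ᶻ G *ᶻ cube (A *ᶻ B)
      ≡⟨ collect′ (t k l) (K *ᶻ L) G (A *ᶻ B) ⟩
    t k l *ᶻ G *ᶻ cube (A *ᶻ B *ᶻ (K *ᶻ L)) ∎)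
    where
    t′ A B K L G : ℤ
    t′ = t (k * p) (l * p)
    A  = p^ k
    B  = p^ l
    K  = fac k
    L  = fac l
    G  = F (k + l) *ᶻ F (k + k) *ᶻ F (l + l)

    nonZero : ℤ.NonZero (cube (A *ᶻ B *ᶻ (K *ᶻ L)))
    nonZero = cube≢0 (A *ᶻ B *ᶻ (K *ᶻ L)) {{ℤ.i*j≢0 (A *ᶻ B) (K *ᶻ L)
      {{ℤ.i*j≢0 A B {{ℕ.m^n≢0 p k}} {{ℕ.m^n≢0 p l}}}}
      {{ℤ.i*j≢0 K L {{fac≢0 k}} {{fac≢0 l}}}}}}

    fac-F-+ : ∀ a b → fac (a * p + b * p) ≡ p^ a *ᶻ p^ b *ᶻ fac (a + b) *ᶻ F (a + b)
    fac-F-+ a b = begin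
      fac (a * p + b * p)                          ≡⟨ cong fac (ℕ.*-distribʳ-+ p a b) ⟨
      fac ((a + b) * p)                            ≡⟨ fac-F (a + b) ⟩
      p^ (a + b) *ᶻ fac (a + b) *ᶻ F (a + b)       ≡⟨ cong (λ x → x *ᶻ fac (a + b) *ᶻ F (a + b)) (p^-+ a b) ⟩
      p^ a *ᶻ p^ b *ᶻ fac (a + b) *ᶻ F (a + b)     ∎

    cube-* : ∀ x y → cube (x *ᶻ y) ≡ cube x *ᶻ cube y
    cube-* = identity
      where
      identity : ∀ x y → x *ᶻ y *ᶻ (x *ᶻ y) *ᶻ (x *ᶻ y) ≡ x *ᶻ x *ᶻ x *ᶻ (y *ᶻ y *ᶻ y)
      identity = solve-∀

    collect : ∀ t A B K L X Y → t *ᶻ cube (X *ᶻ Y) *ᶻ cube (A *ᶻ B *ᶻ (K *ᶻ L))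
      ≡ t *ᶻ cube (A *ᶻ K *ᶻ X *ᶻ (B *ᶻ L *ᶻ Y))
    collect t A B K L X Y = begin
      t *ᶻ cube (X *ᶻ Y) *ᶻ cube (A *ᶻ B *ᶻ (K *ᶻ L))
        ≡⟨ ℤ.*-assoc t (cube (X *ᶻ Y)) _ ⟩
      t *ᶻ (cube (X *ᶻ Y) *ᶻ cube (A *ᶻ B *ᶻ (K *ᶻ L)))
        ≡⟨ cong (t *ᶻ_) (cube-* (X *ᶻ Y) (A *ᶻ B *ᶻ (K *ᶻ L))) ⟨
      t *ᶻ cube (X *ᶻ Y *ᶻ (A *ᶻ B *ᶻ (K *ᶻ L)))
        ≡⟨ cong (λ x → t *ᶻ cube x) (identity A B K L X Y) ⟩
      t *ᶻ cube (A *ᶻ K *ᶻ X *ᶻ (B *ᶻ L *ᶻ Y)) ∎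
      where
      identity : ∀ A B K L X Y → X *ᶻ Y *ᶻ (A *ᶻ B *ᶻ (K *ᶻ L)) ≡ A *ᶻ K *ᶻ X *ᶻ (B *ᶻ L *ᶻ Y)
      identity = solve-∀

    regroup : ∀ A B P K L X Y Z →
      A *ᶻ B *ᶻ P *ᶻ X *ᶻ (A *ᶻ A *ᶻ K *ᶻ Y) *ᶻ (B *ᶻ B *ᶻ L *ᶻ Z)
      ≡ P *ᶻ K *ᶻ L *ᶻ (X *ᶻ Y *ᶻ Z) *ᶻ (A *ᶻ B *ᶻ (A *ᶻ B) *ᶻ (A *ᶻ B))
    regroup = solve-∀

    collect′ : ∀ t y G x → t *ᶻ (y *ᶻ y *ᶻ y) *ᶻ G *ᶻ (x *ᶻ x *ᶻ x)
      ≡ t *ᶻ G *ᶻ (x *ᶻ y *ᶻ (x *ᶻ y) *ᶻ (x *ᶻ y))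
    collect′ = solve-∀

  -- Shifted products of blocks and near-multiplicativity of the p-free factorial

  H : ℤ → ℕ → ℤ
  H x = ∏ (λ i _ → block (x +ᶻ + (i * p)))

  -- `H x b` consists of b + 1 blocks, whence the successor on the left.
  F-+-suc : ∀ a b → F (a + suc b) ≡ F a *ᶻ H (+ (a * p)) b
  F-+-suc a zero = begin
    F (a + 1)                           ≡⟨ cong F (ℕ.+-comm a 1) ⟩
    F a *ᶻ block (+ (a * p))            ≡⟨ cong (λ m → F a *ᶻ block (+ m)) (ℕ.+-identityʳ (a * p)) ⟨
    F a *ᶻ block (+ (a * p + 0))        ∎
  F-+-suc a (suc b) = begin
    F (a + suc (suc b))
      ≡⟨ cong F (ℕ.+-suc a (suc b)) ⟩
    F (a + suc b) *ᶻ block (+ ((a + suc b) * p))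
      ≡⟨ cong₂ (λ x m → x *ᶻ block (+ m)) (F-+-suc a b) (ℕ.*-distribʳ-+ p a (suc b)) ⟩
    F a *ᶻ H (+ (a * p)) b *ᶻ block (+ (a * p + suc b * p))
      ≡⟨ ℤ.*-assoc (F a) (H (+ (a * p)) b) _ ⟩
    F a *ᶻ (H (+ (a * p)) b *ᶻ block (+ (a * p + suc b * p)))
      ≡⟨ cong (F a *ᶻ_) (∏-last (λ i _ → block (+ (a * p) +ᶻ + (i * p))) b) ⟨
    F a *ᶻ H (+ (a * p)) (suc b) ∎

  block-∤ : ∀ n → ¬ + p ∣ᶻ block (+ (n * p))
  block-∤ n = ∏-∤ {λ j _ → + (n * p) +ᶻ (1ℤ +ᶻ + j)} q λ j j′ j+j′≡q p∣ →
    ℕ.>⇒∤ (s≤s (s≤s (subst (j ≤_) j+j′≡q (ℕ.m≤m+n j j′))))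
      (ℕ.∣m+n∣m⇒∣n (ℤ.∣⇒∣ᵤ p∣) (ℕ.∣n⇒∣m*n n ℕ.∣-refl))

  F-∤ : ∀ n → ¬ + p ∣ᶻ F n
  F-∤ zero    p∣1 = ℕ.>⇒∤ (s≤s (s≤s z≤n)) (ℤ.∣⇒∣ᵤ p∣1)
  F-∤ (suc n) = ∤-* {F n} {block (+ (n * p))} (F-∤ n) (block-∤ n)

  H₀-∤ : ∀ n → ¬ + p ∣ᶻ H 0ℤ n
  H₀-∤ n = ∏-∤ {λ i _ → block (0ℤ +ᶻ + (i * p))} n (λ i _ _ → block-∤ i)

  -- Oddness of p enters here: x + y is congruent to 2y, hence prime to p, and can be cancelled from
  -- x² - y² = (x + y)(x - y).
  square-mod-cancel : ∀ j x y → ¬ + p ∣ᶻ y → x ≡ y [mod + p ] →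
    x *ᶻ x ≡ y *ᶻ y [mod p^ j ] → x ≡ y [mod p^ j ]
  square-mod-cancel j x y p∤y p∣x-y h =
    ∣ᶻ-coprime-cancel (x +ᶻ y) (x -ᶻ y) j p∤x+y (subst (p^ j ∣ᶻ_) (factor x y) h)
    where
    factor : ∀ x y → x *ᶻ x -ᶻ y *ᶻ y ≡ (x +ᶻ y) *ᶻ (x -ᶻ y)
    factor = solve-∀

    difference : ∀ x y → x +ᶻ y -ᶻ (x -ᶻ y) ≡ + 2 *ᶻ y
    difference = solve-∀

    p∤2 : ¬ + p ∣ᶻ + 2
    p∤2 p∣2 = p-odd (ℕ.∣-reflexive (ℕ.≤-antisym (s≤s (s≤s z≤n)) (ℕ.∣⇒≤ (ℤ.∣⇒∣ᵤ p∣2))))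

    p∤x+y : ¬ + p ∣ᶻ x +ᶻ y
    p∤x+y p∣x+y = ∤-* {+ 2} {y} p∤2 p∤y
      (subst (+ p ∣ᶻ_) (difference x y) (ℤ.∣m∣n⇒∣m-n p∣x+y p∣x-y))

  -- One copy is reversed at both levels, so each factor meets its mirror image. Squaring achieves
  -- this pairing without cutting the product into halves.
  H-square : ∀ x n → H x n *ᶻ H x n ≡
    ∏ (λ i i′ → ∏ (λ j j′ →
      (x +ᶻ + (i * p) +ᶻ (1ℤ +ᶻ + j)) *ᶻ (x +ᶻ + (i′ * p) +ᶻ (1ℤ +ᶻ + j′))) q) n
  H-square x n = begin
    H x n *ᶻ H x n
      ≡⟨ cong (H x n *ᶻ_) (trans (∏-flip (λ i _ → block (x +ᶻ + (i * p))) n)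
           (∏-cong n (λ _ i′ _ → ∏-flip (λ j _ → x +ᶻ + (i′ * p) +ᶻ (1ℤ +ᶻ + j)) q))) ⟩
    H x n *ᶻ ∏ (λ _ i′ → ∏ (λ _ j′ → x +ᶻ + (i′ * p) +ᶻ (1ℤ +ᶻ + j′)) q) n
      ≡⟨ ∏-* (λ i _ → block (x +ᶻ + (i * p))) _ n ⟨
    _ ≡⟨ ∏-cong n (λ i i′ _ → sym (∏-* (λ j _ → x +ᶻ + (i * p) +ᶻ (1ℤ +ᶻ + j))
           (λ _ j′ → x +ᶻ + (i′ * p) +ᶻ (1ℤ +ᶻ + j′)) q)) ⟩
    _ ∎

  -- The factors c and c′ at opposite ends satisfy c + c′ = (n+1)p, and
  -- (x + c)(x + c′) - c c′ = x (x + c + c′) is divisible by d².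
  H-square-mod : ∀ d x n → d ∣ᶻ x → d ∣ᶻ + (suc n * p) →
    H x n *ᶻ H x n ≡ H 0ℤ n *ᶻ H 0ℤ n [mod d *ᶻ d ]
  H-square-mod d x n d∣x d∣n = subst₂ (λ a b → a ≡ b [mod d *ᶻ d ])
    (sym (H-square x n)) (sym (H-square 0ℤ n))
    (∏-mod n λ i i′ i+i′≡n → ∏-mod q λ j j′ j+j′≡q →
      subst (d *ᶻ d ∣ᶻ_) (identity x (+ (i * p)) (+ (i′ * p)) (1ℤ +ᶻ + j) (1ℤ +ᶻ + j′))
        (∣-*-mono d∣x (ℤ.∣m∣n⇒∣m+n d∣x
          (subst (λ m → d ∣ᶻ + m) (sym (total i i′ j j′ i+i′≡n j+j′≡q)) d∣n))))
    where
    identity : ∀ x a a′ b b′ → x *ᶻ (x +ᶻ (a +ᶻ a′ +ᶻ (b +ᶻ b′)))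
      ≡ (x +ᶻ a +ᶻ b) *ᶻ (x +ᶻ a′ +ᶻ b′) -ᶻ (0ℤ +ᶻ a +ᶻ b) *ᶻ (0ℤ +ᶻ a′ +ᶻ b′)
    identity = solve-∀

    total : ∀ i i′ j j′ → i + i′ ≡ n → j + j′ ≡ q →
      i * p + i′ * p + (suc j + suc j′) ≡ suc n * p
    total i i′ j j′ refl j+j′≡q = begin
      i * p + i′ * p + (suc j + suc j′) ≡⟨ cong₂ _+_ (sym (ℕ.*-distribʳ-+ p i i′))
                                             (trans (cong suc (ℕ.+-suc j j′)) (cong (suc ∘ suc) j+j′≡q)) ⟩
      (i + i′) * p + p                  ≡⟨ ℕ.+-comm ((i + i′) * p) p ⟩
      suc (i + i′) * p                  ∎

  H-mod-p : ∀ x n → + p ∣ᶻ x → H x n ≡ H 0ℤ n [mod + p ]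
  H-mod-p x n p∣x = ∏-mod n λ i _ _ → ∏-mod q λ j _ _ →
    subst (+ p ∣ᶻ_) (identity x (+ (i * p)) (1ℤ +ᶻ + j)) p∣x
    where
    identity : ∀ x a b → x ≡ x +ᶻ a +ᶻ b -ᶻ (0ℤ +ᶻ a +ᶻ b)
    identity = solve-∀

  -- F(a+b)/F(a) and F(b) are the block products `H` started at a p and at 0. Both a p and b p are
  -- multiples of d = p^(s+1), so the squares agree modulo d², and then so do the products.
  F-+-mod : ∀ s a b → p ^ s ∣ a → p ^ s ∣ b → F (a + b) ≡ F a *ᶻ F b [mod p^ (suc s + suc s) ]
  F-+-mod s a zero    _ _ =
    mod-reflexive (trans (cong F (ℕ.+-identityʳ a)) (sym (ℤ.*-identityʳ (F a))))
  F-+-mod s a (suc b) p^s∣a p^s∣b = subst₂ (λ x y → x ≡ F a *ᶻ y [mod p^ (suc s + suc s) ])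
    (sym (F-+-suc a b)) (trans (sym (ℤ.*-identityˡ (H 0ℤ b))) (sym (F-+-suc 0 b)))
    (mod-* (F a) (F a) (H x b) (H 0ℤ b) (mod-refl (F a))
      (square-mod-cancel (suc s + suc s) (H x b) (H 0ℤ b) (H₀-∤ b)
        (H-mod-p x b (p^-suc-∣ s p^ss∣x))
        (subst (H x b *ᶻ H x b ≡ H 0ℤ b *ᶻ H 0ℤ b [mod_]) (sym (p^-+ (suc s) (suc s)))
          (H-square-mod (p^ suc s) x b p^ss∣x (multiple p^s∣b)))))
    where
    x : ℤ
    x = + (a * p)

    multiple : ∀ {m} → p ^ s ∣ m → p^ suc s ∣ᶻ + (m * p)
    multiple {m} h = ℤ.∣ᵤ⇒∣ (subst (_∣ m * p) (ℕ.*-comm (p ^ s) p) (ℕ.*-monoˡ-∣ p h))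

    p^ss∣x : p^ suc s ∣ᶻ x
    p^ss∣x = multiple p^s∣a

  -- The exponent splits as 2j + (2s+2) with s + j = r: the first part comes from `t k l`, the
  -- second from the congruence between the two products of values of `F`. The factor `U` is prime
  -- to p and cancels.
  t-multiple-mod : ∀ r k l → p ^ r ∣ k + l → t (k * p) (l * p) ≡ t k l [mod p^ (suc r + suc r) ]
  t-multiple-mod r k l h with t-∣ r k l h
  ... | s , j , refl , p^s∣k , p^2j∣t =
    ∣ᶻ-coprime-cancel U (t (k * p) (l * p) -ᶻ t k l) (suc r + suc r)
      (∤-cube (∤-* {F k} {F l} (F-∤ k) (F-∤ l)))
      (subst₂ _∣ᶻ_ modulus difference (∣-*-mono p^2j∣t V≡U))
    where
    U V : ℤ
    U = cube (F k *ᶻ F l)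
    V = F (k + l) *ᶻ F (k + k) *ᶻ F (l + l)

    p^s∣l : p ^ s ∣ l
    -- Since s ≤ r, p^s divides k + l as well as k.
    p^s∣l = ℕ.∣m+n∣m⇒∣n (ℕ.∣-trans (subst (p ^ s ∣_) (sym (ℕ.^-distribˡ-+-* p s j)) (ℕ.m∣m*n (p ^ j))) h) p^s∣k

    e : ℕ
    e = suc s + suc s

    V≡U : V ≡ U [mod p^ e ]
    V≡U = subst (V ≡_[mod p^ e ]) (identity (F k) (F l))
      (mod-* (F (k + l) *ᶻ F (k + k)) (F k *ᶻ F l *ᶻ (F k *ᶻ F k)) (F (l + l)) (F l *ᶻ F l)
        (mod-* (F (k + l)) (F k *ᶻ F l) (F (k + k)) (F k *ᶻ F k)
          (F-+-mod s k l p^s∣k p^s∣l) (F-+-mod s k k p^s∣k p^s∣k))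
        (F-+-mod s l l p^s∣l p^s∣l))
      where
      identity : ∀ x y → x *ᶻ y *ᶻ (x *ᶻ x) *ᶻ (y *ᶻ y) ≡ x *ᶻ y *ᶻ (x *ᶻ y) *ᶻ (x *ᶻ y)
      identity = solve-∀

    modulus : p^ (j + j) *ᶻ p^ e ≡ p^ (suc (s + j) + suc (s + j))
    modulus = trans (sym (p^-+ (j + j) e)) (cong p^_ (exponent s j))
      where
      exponent : ∀ s j → j + j + (suc s + suc s) ≡ suc (s + j) + suc (s + j)
      exponent = ℕ-Ring.solve-∀

    difference : t k l *ᶻ (V -ᶻ U) ≡ U *ᶻ (t (k * p) (l * p) -ᶻ t k l)
    difference = begin
      t k l *ᶻ (V -ᶻ U)                          ≡⟨ distrib (t k l) V U ⟩
      t k l *ᶻ V -ᶻ U *ᶻ t k l                   ≡⟨ cong (_-ᶻ U *ᶻ t k l) (t-multiple k l) ⟨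
      t (k * p) (l * p) *ᶻ U -ᶻ U *ᶻ t k l       ≡⟨ factor (t (k * p) (l * p)) U (t k l) ⟩
      U *ᶻ (t (k * p) (l * p) -ᶻ t k l)          ∎
      where
      distrib : ∀ t v u → t *ᶻ (v -ᶻ u) ≡ t *ᶻ v -ᶻ u *ᶻ t
      distrib = solve-∀
      factor : ∀ t′ u t → t′ *ᶻ u -ᶻ u *ᶻ t ≡ u *ᶻ (t′ -ᶻ t)
      factor = solve-∀

  -- Since p^(r+1) divides n p, terms whose index is prime to p vanish modulo p^(2r+2); the others
  -- are compared one by one with the terms of `Z n`.
  Z-supercongruence : ∀ r n → p ^ r ∣ n → Z (n * p) ≡ Z n [mod p^ (suc r + suc r) ]
  Z-supercongruence r n h = mod-trans
    (Z (n * p)) (∑ (λ k l → t (k * p) (l * p)) n) (Z n)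
    (∑-multiples (suc q) t n λ k l k+l≡ p∤k → t-∣-coprime (suc r) k l
      (subst₂ _∣_ (ℕ.*-comm (p ^ r) p) (sym k+l≡) (ℕ.*-monoˡ-∣ p h)) p∤k)
    (∑-mod n λ k l k+l≡n → t-multiple-mod r k l (subst (p ^ r ∣_) (sym k+l≡n) h))

-- The recurrence at multiples of a prime power, and the conclusion

module _ {p : ℕ} (p-prime : Prime p) {S : ℕ → ℤ} (isS : IsS S) where
  open PrimePowers p-prime
  open IsS isS

  -- At index n the recurrence reads (n+1)² (S (n+1) − 4 (n+1) S n) = −4 n² (n S n + 8 S (n−1)).
  S-suc-mod : ∀ r n → 1 ≤ n → p ^ suc r ∣ n →
    S (n + 1) ≡ + 4 *ᶻ + (n + 1) *ᶻ S n [mod p^ (suc r + suc r) ]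
  S-suc-mod r n 1≤n p^r∣n = ∣ᶻ-coprime-cancel (+ (n + 1) *ᶻ + (n + 1)) _ (suc r + suc r)
    (∤-* {+ (n + 1)} {+ (n + 1)} p∤n+1 p∤n+1)
    (subst₂ _∣ᶻ_ (sym (p^-+ (suc r) (suc r))) (sym factored)
      (ℤ.∣m⇒∣m*n {m = + n *ᶻ + n} w (∣-*-mono p^r∣ᶻn p^r∣ᶻn)))
    where
    w : ℤ
    w = - (+ 4 *ᶻ (+ n *ᶻ S n +ᶻ + 8 *ᶻ S (n ∸ 1)))

    p^r∣ᶻn : p^ suc r ∣ᶻ + n
    p^r∣ᶻn = ℤ.∣ᵤ⇒∣ p^r∣n

    p∤n+1 : ¬ + p ∣ᶻ + (n + 1)
    p∤n+1 h = ¬prime[1] (subst Prime (ℕ.∣1⇒≡1 (ℕ.∣m+n∣m⇒∣n (ℤ.∣⇒∣ᵤ h)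
      (ℕ.∣-trans (ℕ.m∣m*n (p ^ r)) p^r∣n))) p-prime)

    factored : + (n + 1) *ᶻ + (n + 1) *ᶻ (S (n + 1) -ᶻ + 4 *ᶻ + (n + 1) *ᶻ S n) ≡ + n *ᶻ + n *ᶻ w
    factored = begin
      _ ≡⟨ expand (+ n) (S (n + 1)) (S n) ⟩
      _ ≡⟨ cong (_-ᶻ + 4 *ᶻ (N *ᶻ N *ᶻ N) *ᶻ S n) (S-rec n 1≤n) ⟩
      _ ≡⟨ collect (+ n) (S n) (S (n ∸ 1)) ⟩
      _ ∎
      where
      N : ℤ
      N = + n +ᶻ 1ℤ
      expand : ∀ n x y → (n +ᶻ 1ℤ) *ᶻ (n +ᶻ 1ℤ) *ᶻ (x -ᶻ + 4 *ᶻ (n +ᶻ 1ℤ) *ᶻ y)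
        ≡ (n +ᶻ 1ℤ) *ᶻ ((n +ᶻ 1ℤ) *ᶻ 1ℤ) *ᶻ x
          -ᶻ + 4 *ᶻ ((n +ᶻ 1ℤ) *ᶻ (n +ᶻ 1ℤ) *ᶻ (n +ᶻ 1ℤ)) *ᶻ y
      expand = solve-∀
      collect : ∀ n y z →
        + 4 *ᶻ (+ 3 *ᶻ (n *ᶻ (n *ᶻ 1ℤ)) +ᶻ + 3 *ᶻ n +ᶻ 1ℤ) *ᶻ y -ᶻ + 32 *ᶻ (n *ᶻ (n *ᶻ 1ℤ)) *ᶻ z
          -ᶻ + 4 *ᶻ ((n +ᶻ 1ℤ) *ᶻ (n +ᶻ 1ℤ) *ᶻ (n +ᶻ 1ℤ)) *ᶻ y
        ≡ n *ᶻ n *ᶻ - (+ 4 *ᶻ (n *ᶻ y +ᶻ + 8 *ᶻ z))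
      collect = solve-∀

theorem3p2 : (S : ℕ → ℤ) → IsS S →
    (p m r : ℕ) → Prime p → ¬ (2 ∣ p) → 1 ≤ m → 1 ≤ r →
    S (m * p ^ r + 1) ≡ + 4 ℤ.* + (m * p ^ r + 1) ℤ.* S (m * p ^ (r ∸ 1)) [mod + (p ^ (2 * r)) ]
theorem3p2 S isS zero          m r       p-prime _     _   _ = ⊥-elim (¬prime[0] p-prime)
theorem3p2 S isS (suc zero)    m r       p-prime _     _   _ = ⊥-elim (¬prime[1] p-prime)
theorem3p2 S isS p@(suc (suc _)) m (suc r) p-prime p-odd 1≤m _ =
  -- The exponent `2 * suc r` unfolds to `suc r + (suc r + 0)`; the trailing zero is removed here.
  subst (λ e → S (n + 1) ≡ c *ᶻ S n′ [mod + (p ^ (suc r + e)) ]) (sym (ℕ.+-identityʳ (suc r)))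
    (mod-trans (S (n + 1)) (c *ᶻ S n) (c *ᶻ S n′)
      (S-suc-mod p-prime isS r n (ℕ.*-mono-≤ 1≤m (ℕ.m^n>0 p (suc r))) (ℕ.∣n⇒∣m*n m ℕ.∣-refl))
      (mod-* c c (S n) (S n′) (mod-refl c)
        (subst₂ (_≡_[mod + (p ^ (suc r + suc r)) ])
          (sym (trans (S≡Z n) (cong Z n≡))) (sym (S≡Z n′))
          (Z-supercongruence r n′ (ℕ.∣n⇒∣m*n m ℕ.∣-refl)))))
  where
  open OddPrime p-prime p-odd using (Z-supercongruence)
  open Recurrence isS using (S≡Z)

  n n′ : ℕ
  n  = m * p ^ suc r
  n′ = m * p ^ r

  c : ℤ
  c = + 4 *ᶻ + (n + 1)

  n≡ : n ≡ n′ * p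
  n≡ = trans (cong (m *_) (ℕ.*-comm p (p ^ r))) (sym (ℕ.*-assoc m (p ^ r) p))
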